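{- A sync computon can always be constructed in a category of computons. That is, for any computons $\lambda_1$ and $\lambda_2$ in a computon category there exist a glue $\lambda_3$ and a sequentiable span $\rho := \big((\lambda_1+\lambda_2)\xleftarrow{\alpha_1}\lambda_4\xrightarrow{\alpha_2}\lambda_3\big)$ that identifies all the control outports of $\lambda_1+\lambda_2$ with all the inports of $\lambda_3$, i.e. $\alpha_1(P_4)$ is the set of all outports of $\lambda_1+\lambda_2$ of type $0$ and $\alpha_2(P_4)=P_3^+$; consequently the sync computon $(\lambda_1+\lambda_2)\rhd_\rho\lambda_3$ or $(\lambda_1+\lambda_2)\unrhd_\rho\lambda_3$ (the pushout of $\rho$) exists.
   Context: Fix $n\ge 1$, the set of types $\underline{n}:=\{0,1,\dots,n-1\}$ (type $0$ is the control type), and a finite nonempty set $B\subset\Sigma^*$ of computing devices over a finite alphabet $\Sigma$, with a distinguished element $\epsilon\in B$. All computons are over these fixed $\underline{n}$ and $B$. **Computon.** A computon $\lambda$ is a tuple $(U,P,I,O,\underline{n},B,\sigma,t,\tau,s,c,r,f)$ where $U$ (computation units), $I$ (inflows), $O$ (outflows) are finite sets, $P$ (ports) is a finite nonempty set, $\sigma\colon O\to U$, $\tau\colon I\to U$ and $r\colon I\to O$ are surjective functions, and $t\colon O\to P$, $s\colon I\to P$, $c\colon P\to\underline{n}$, $f\colon O\to B$ are functions, such that: the restrictions of $\tau$ to $(c\circ s)^{ -1}(0)$ and of $\sigma$ to $(c\circ t)^{ -1}(0)$ are surjective onto $U$; $\sigma\circ r=\tau$; and there exist $p\in P\setminus t(O)$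 and $q\in P\setminus s(I)$ with $c(p)=0=c(q)$. Components of a computon $\lambda_k$ carry the index $k$. Write $P^+:=P\setminus t(O)$ (inports), $P^-:=P\setminus s(I)$ (outports), and for $p\in P$ write $p\bullet:=\tau(s^{ -1}(p))$ and $\bullet p:=\sigma(t^{ -1}(p))$. A control outport is a port $p\in P^-$ with $c(p)=0$. **Morphism.** A computon morphism $\alpha\colon\lambda_1\to\lambda_2$ consists of functions $\alpha_U\colon U_1\to U_2$, $\alpha_P\colon P_1\to P_2$, $\alpha_I\colon I_1\to I_2$, $\alpha_O\colon O_1\to O_2$ and the inclusions (identities) on $\underline{n}$ and on $B$, such that $\alpha_U\tau_1=\tau_2\alpha_I$, $\alpha_U\sigma_1=\sigma_2\alpha_O$, $\alpha_P s_1=s_2\alpha_I$, $\alpha_P t_1=t_2\alpha_O$, $\alpha_O r_1=r_2\alpha_I$, $f_2\alpha_O=f_1$, $c_2\alpha_P=c_1$, and $\vec{i}(\alpha)\cup\vec{o}(\alpha)\subseteq P_1^+\cup P_1^-$, where $\vec{i}(\alpha)=\{p\in P_1\mid \bullet\alpha_P(p)\setminus\alpha_U(\bullet p)\ne\emptyset\}$ and $\vec{o}(\alpha)=\{p\in P_1\mid \alpha_P(p)\bullet\setminus\alpha_U(p\bullet)\neq\emptyset\}$. Morphisms compose componentwise; a monomorphism is a morphism all of whose components are injective. **Trivial, primitive, glue.** A computon is trivial if $U=I=O=\emptyset$. It is primitive if $|U|=1$, $P\cong I\sqcup O$ (bijection of sets) and $s$ and $t$ are injective. A glue is a primitive computon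 with $c(p)=0$ for all $p\in P$. **Coproduct.** $\lambda_1+\lambda_2$ is the coproduct of $\lambda_1$ and $\lambda_2$: its sets of units, ports, inflows and outflows are the disjoint unions $U_1\sqcup U_2$, $P_1\sqcup P_2$, $I_1\sqcup I_2$, $O_1\sqcup O_2$, and each structure function $\sigma,t,\tau,s,c,r,f$ is given by the corresponding function of $\lambda_1$ on elements coming from $\lambda_1$ and of $\lambda_2$ on elements coming from $\lambda_2$. **Pushout.** The pushout $\lambda_1+_{\lambda_0}\lambda_2$ of a span $\lambda_1\xleftarrow{\alpha_1}\lambda_0\xrightarrow{\alpha_2}\lambda_2$ is formed componentwise: its sets of units, ports, inflows and outflows are the pushouts of finite sets $U_1\sqcup_{U_0}U_2$, $P_1\sqcup_{P_0}P_2$, $I_1\sqcup_{I_0}I_2$, $O_1\sqcup_{O_0}O_2$, with the induced structure functions (over the same $\underline{n}$ and $B$). **Sequencing.** A span $\lambda_1\xleftarrow{\alpha_1}\lambda_0\xrightarrow{\alpha_2}\lambda_2$ is sequentiable if $\lambda_0$ is a trivial computon and $\alpha_1,\alpha_2$ are monomorphisms with $\alpha_1(P_0)\subseteq P_1^-$ and $\alpha_2(P_0)\subseteq P_2^+$. It is a known fact that the pushout of every sequentiable span exists in the category of computons. The pushout of a sequentiable span $\rho$ is called the total sequential computon $\lambda_1\unrhd_\rho\lambda_2$ if $\alpha_1(P_0)=P_1^-$ and $\alpha_2(P_0)=P_2^+$; otherwise it is called the partial sequential computon $\lambda_1\rhd_\rho\lambda_2$. **Sync computon.** Given computons $\lambda_1$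 and $\lambda_2$, a sync computon is a composite $(\lambda_1+\lambda_2)\,\square\,\lambda_3$ where $\lambda_3$ is a glue, $\square\in\{\rhd_\rho,\unrhd_\rho\}$, and $\rho$ is a sequentiable span that identifies all the control outports of $\lambda_1+\lambda_2$ with all the inports of $\lambda_3$. -}

module Defs where

open import Data.Fin.Base using (Fin; toℕ)
open import Data.Fin.Properties using (+↔⊎)
open import Data.List.Base using (List)
import Data.List.Membership.Propositional as List
open import Data.Nat.Base using (ℕ; _≥_) renaming (_+_ to _+ℕ_)
open import Data.Product using (∃; ∃!; _×_; _,_)
open import Data.Sum.Base as Sum using (_⊎_; inj₁; inj₂; [_,_]′)
open import Data.Sum.Function.Propositional using (_⊎-↔_)
open import Function.Base using (_∘_)
open import Function.Bundles using (_↔_)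
open import Function.Construct.Composition using (_↔-∘_)
open import Function.Construct.Symmetry using (↔-sym)
open import Function.Definitions using (Injective; StrictlySurjective)
open import Level using (0ℓ)
open import Relation.Binary.PropositionalEquality
  using (_≡_; refl; cong; _≗_)
open import Relation.Nullary.Negation.Core using (¬_)
open import Relation.Unary
  using (Pred; _∈_; _⊆_; _≐_; _∪_; _∩_; _∖_; ∁; Satisfiable)

private
  variable
    A B C D : Set

Finite : Set → Set
Finite A = ∃ λ k → A ↔ Fin k

finite-⊎ : Finite A → Finite B → Finite (A ⊎ B)
finite-⊎ (m , A↔m) (n , B↔n) = m +ℕ n , ↔-sym +↔⊎ ↔-∘ (A↔m ⊎-↔ B↔n)

range : (A → B) → Pred B 0ℓ
range g y = ∃ λ x → g x ≡ y

image : (A → B) → Pred A 0ℓ → Pred B 0ℓ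
image g X y = ∃ λ x → x ∈ X × g x ≡ y

fibre : (A → B) → B → Pred A 0ℓ
fibre g y x = g x ≡ y

-- The types are Fin n, with control type 0.  The finite set of devices is
-- given by a list; its order and repetitions are irrelevant, as only
-- membership is used.
record Signature : Set₁ where
  field
    n               : ℕ
    n≥1             : n ≥ 1
    Alphabet        : Set
    finite-Alphabet : Finite Alphabet
    devices         : List (List Alphabet)
    ε               : List Alphabet
    ε∈devices       : ε List.∈ devices

-- P is nonempty by has-control-inport.
record Computon (S : Signature) : Set₁ where
  open Signature S
  field
    U P I O  : Set
    finite-U : Finite U
    finite-P : Finite P
    finite-I : Finite I
    finite-O : Finite O
    σ : O → U
    t : O → P
    τ : I → U
    s : I → P
    c : P → Fin n
    r : I → O
    f : O → List Alphabet
    f∈devices : ∀ o → f o List.∈ devices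

  Control : Pred P 0ℓ
  Control p = toℕ (c p) ≡ 0

  InPort : Pred P 0ℓ
  InPort = ∁ (range t)

  OutPort : Pred P 0ℓ
  OutPort = ∁ (range s)

  field
    σ-surjective : StrictlySurjective _≡_ σ
    τ-surjective : StrictlySurjective _≡_ τ
    r-surjective : StrictlySurjective _≡_ r
    τ-control-surjective : ∀ u → ∃ λ i → s i ∈ Control × τ i ≡ u
    σ-control-surjective : ∀ u → ∃ λ o → t o ∈ Control × σ o ≡ u
    σ∘r≗τ : σ ∘ r ≗ τ
    has-control-inport  : ∃⟨ InPort ∩ Control ⟩
    has-control-outport : ∃⟨ OutPort ∩ Control ⟩

  infix 10 _• •_

  _• : P → Pred U 0ℓ
  p • = image τ (fibre s p)

  •_ : P → Pred U 0ℓ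
  • p = image σ (fibre t p)

open Computon using (InPort; OutPort; Control)

private
  variable
    S : Signature

record Morphism (L₁ L₂ : Computon S) : Set where
  private
    module L₁ = Computon L₁
    module L₂ = Computon L₂
  field
    mapU : L₁.U → L₂.U
    mapP : L₁.P → L₂.P
    mapI : L₁.I → L₂.I
    mapO : L₁.O → L₂.O
    comm-τ : mapU ∘ L₁.τ ≗ L₂.τ ∘ mapI
    comm-σ : mapU ∘ L₁.σ ≗ L₂.σ ∘ mapO
    comm-s : mapP ∘ L₁.s ≗ L₂.s ∘ mapI
    comm-t : mapP ∘ L₁.t ≗ L₂.t ∘ mapO
    comm-r : mapO ∘ L₁.r ≗ L₂.r ∘ mapI
    comm-f : L₂.f ∘ mapO ≗ L₁.f
    comm-c : L₂.c ∘ mapP ≗ L₁.c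

  i⃗ : Pred L₁.P 0ℓ
  i⃗ p = ∃⟨ L₂.• mapP p ∖ image mapU (L₁.• p) ⟩

  o⃗ : Pred L₁.P 0ℓ
  o⃗ p = ∃⟨ (mapP p L₂.•) ∖ image mapU (p L₁.•) ⟩

  field
    boundary : (i⃗ ∪ o⃗) ⊆ (L₁.InPort ∪ L₁.OutPort)

record Mono {L₁ L₂ : Computon S} (α : Morphism L₁ L₂) : Set where
  open Morphism α
  field
    injective-U : Injective _≡_ _≡_ mapU
    injective-P : Injective _≡_ _≡_ mapP
    injective-I : Injective _≡_ _≡_ mapI
    injective-O : Injective _≡_ _≡_ mapO

record Trivial (L : Computon S) : Set where
  open Computon L
  field
    no-U : ¬ U
    no-I : ¬ I
    no-O : ¬ O

record Primitive (L : Computon S) : Set where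
  open Computon L
  field
    one-unit    : U ↔ Fin 1
    P↔I⊎O       : P ↔ (I ⊎ O)
    s-injective : Injective _≡_ _≡_ s
    t-injective : Injective _≡_ _≡_ t

record Glue (L : Computon S) : Set where
  field
    isPrimitive : Primitive L
    all-control : ∀ p → p ∈ Control L

infixr 6 _+_

_+_ : Computon S → Computon S → Computon S
L₁ + L₂ = record
  { U = L₁.U ⊎ L₂.U
  ; P = L₁.P ⊎ L₂.P
  ; I = L₁.I ⊎ L₂.I
  ; O = L₁.O ⊎ L₂.O
  ; finite-U = finite-⊎ L₁.finite-U L₂.finite-U
  ; finite-P = finite-⊎ L₁.finite-P L₂.finite-P
  ; finite-I = finite-⊎ L₁.finite-I L₂.finite-I
  ; finite-O = finite-⊎ L₁.finite-O L₂.finite-O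
  ; σ = Sum.map L₁.σ L₂.σ
  ; t = Sum.map L₁.t L₂.t
  ; τ = Sum.map L₁.τ L₂.τ
  ; s = Sum.map L₁.s L₂.s
  ; c = [ L₁.c , L₂.c ]′
  ; r = Sum.map L₁.r L₂.r
  ; f = [ L₁.f , L₂.f ]′
  ; f∈devices = λ where
      (inj₁ o) → L₁.f∈devices o
      (inj₂ o) → L₂.f∈devices o
  ; σ-surjective = surjective-⊎ L₁.σ-surjective L₂.σ-surjective
  ; τ-surjective = surjective-⊎ L₁.τ-surjective L₂.τ-surjective
  ; r-surjective = surjective-⊎ L₁.r-surjective L₂.r-surjective
  ; τ-control-surjective = λ where
      (inj₁ u) → let i , ctl , eq = L₁.τ-control-surjective u in inj₁ i , ctl , cong inj₁ eq
      (inj₂ u) → let i , ctl , eq = L₂.τ-control-surjective u in inj₂ i , ctl , cong inj₂ eq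
  ; σ-control-surjective = λ where
      (inj₁ u) → let o , ctl , eq = L₁.σ-control-surjective u in inj₁ o , ctl , cong inj₁ eq
      (inj₂ u) → let o , ctl , eq = L₂.σ-control-surjective u in inj₂ o , ctl , cong inj₂ eq
  ; σ∘r≗τ = λ where
      (inj₁ i) → cong inj₁ (L₁.σ∘r≗τ i)
      (inj₂ i) → cong inj₂ (L₂.σ∘r≗τ i)
  ; has-control-inport =
      let p , inp , ctl = L₁.has-control-inport
      in inj₁ p , (λ { (inj₁ o , refl) → inp (o , refl) }) , ctl
  ; has-control-outport =
      let p , outp , ctl = L₁.has-control-outport
      in inj₁ p , (λ { (inj₁ i , refl) → outp (i , refl) }) , ctl
  }
  where
  module L₁ = Computon L₁
  module L₂ = Computon L₂

  surjective-⊎ : {g : A → B} {h : C → D} →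
                 StrictlySurjective _≡_ g → StrictlySurjective _≡_ h →
                 StrictlySurjective _≡_ (Sum.map g h)
  surjective-⊎ g-surj h-surj (inj₁ y) = let x , eq = g-surj y in inj₁ x , cong inj₁ eq
  surjective-⊎ g-surj h-surj (inj₂ y) = let x , eq = h-surj y in inj₂ x , cong inj₂ eq

record Span (L₁ L₂ : Computon S) : Set₁ where
  field
    L₀ : Computon S
    α₁ : Morphism L₀ L₁
    α₂ : Morphism L₀ L₂

  open Morphism α₁ public using () renaming (mapP to α₁P)
  open Morphism α₂ public using () renaming (mapP to α₂P)

-- The square  i ∘ g ≗ j ∘ h  is a pushout of sets.
record IsPushout (g : A → B) (h : A → C) (i : B → D) (j : C → D) : Set₁ where
  field
    commutes  : i ∘ g ≗ j ∘ h
    universal : ∀ {X : Set} (k : B → X) (l : C → X) → k ∘ g ≗ l ∘ h →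
                ∃! _≗_ λ (u : D → X) → (u ∘ i ≗ k) × (u ∘ j ≗ l)

-- The pushout of a span of computons is formed componentwise.  Since ι₁ and
-- ι₂ commute with the structure functions and are jointly surjective in each
-- component, the structure functions of the apex are the induced ones.  The
-- mediating functions out of the apex preserve all structure but may violate
-- the boundary condition of a Morphism, namely at a port shared by L₁ and L₂
-- that is neither an inport nor an outport of the apex.
record Pushout {L₁ L₂ : Computon S} (ρ : Span L₁ L₂) : Set₁ where
  open Span ρ
  field
    apex : Computon S
    ι₁   : Morphism L₁ apex
    ι₂   : Morphism L₂ apex
  private
    module α₁ = Morphism α₁
    module α₂ = Morphism α₂
    module ι₁ = Morphism ι₁
    module ι₂ = Morphism ι₂
  field
    pushout-U : IsPushout α₁.mapU α₂.mapU ι₁.mapU ι₂.mapU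
    pushout-P : IsPushout α₁.mapP α₂.mapP ι₁.mapP ι₂.mapP
    pushout-I : IsPushout α₁.mapI α₂.mapI ι₁.mapI ι₂.mapI
    pushout-O : IsPushout α₁.mapO α₂.mapO ι₁.mapO ι₂.mapO

record Sequentiable {L₁ L₂ : Computon S} (ρ : Span L₁ L₂) : Set where
  open Span ρ
  field
    trivial : Trivial L₀
    mono₁   : Mono α₁
    mono₂   : Mono α₂
    range₁  : range α₁P ⊆ OutPort L₁
    range₂  : range α₂P ⊆ InPort L₂

Total : {L₁ L₂ : Computon S} → Span L₁ L₂ → Set
Total {L₁ = L₁} {L₂ = L₂} ρ = range α₁P ≐ OutPort L₁ × range α₂P ≐ InPort L₂
  where open Span ρ

-- The computons  L₁ ⊵ρ L₂  (unique up to isomorphism).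
record TotalSequential {L₁ L₂ : Computon S} (ρ : Span L₁ L₂) : Set₁ where
  field
    sequentiable : Sequentiable ρ
    total        : Total ρ
    pushout      : Pushout ρ

-- The computons  L₁ ▷ρ L₂  (unique up to isomorphism).
record PartialSequential {L₁ L₂ : Computon S} (ρ : Span L₁ L₂) : Set₁ where
  field
    sequentiable : Sequentiable ρ
    not-total    : ¬ Total ρ
    pushout      : Pushout ρ

IdentifiesControl : {L₁ L₂ : Computon S} → Span L₁ L₂ → Set
IdentifiesControl {L₁ = L₁} {L₂ = L₂} ρ =
  range α₁P ≐ (OutPort L₁ ∩ Control L₁) × range α₂P ≐ InPort L₂
  where open Span ρ

{-# OPTIONS --safe #-}

-- The glue has one inflow for each control outport of L₁ + L₂, all feeding a
-- single unit with a single outflow; L₁ + L₂ has a control outport, so r is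
-- surjective.  As the right leg of the span is the coproduct injection
-- A → A ⊎ ⊤ on ports, the pushout adjoins just one new port to L₁ + L₂, the
-- target of the outflow of the glue.

module Submission where

open import Defs
open import Data.Empty using (⊥; ⊥-elim)
open import Data.Fin.Base using (Fin; zero; suc; toℕ; fromℕ<)
import Data.Fin.Properties as Fin
open import Data.List.Base using (List; length; lookup; map; filter; allFin)
open import Data.List.Membership.Propositional using () renaming (_∈_ to _∈ˡ_)
open import Data.List.Membership.Propositional.Properties
  using (∈-map⁺; ∈-allFin; ∈-filter⁺; ∈-filter⁻; ∈-lookup)
import Data.List.Relation.Unary.All as All
open import Data.List.Relation.Unary.Any using (index)
open import Data.List.Relation.Unary.Any.Properties using (lookup-index)
open import Data.List.Relation.Unary.Unique.Propositional using (Unique; _∷_)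
open import Data.List.Relation.Unary.Unique.Propositional.Properties
  using (map⁺; allFin⁺; filter⁺)
import Data.Nat.Properties as ℕ
open import Data.Product.Base using (∃; _×_; _,_; proj₁; proj₂)
open import Data.Sum.Base as Sum using (_⊎_; inj₁; inj₂; [_,_]; [_,_]′)
open import Data.Sum.Properties using (inj₁-injective; inj₂-injective)
open import Data.Unit.Base using (⊤; tt)
open import Function.Base using (id; const; _∘_; case_of_)
open import Function.Bundles using (Inverse)
open import Function.Construct.Identity using (↔-id)
open import Function.Construct.Symmetry using (↔-sym)
open import Function.Definitions using (Injective)
open import Function.Properties.Inverse using (↔⇒↣)
open import Relation.Binary.Definitions using (DecidableEquality)
open import Relation.Binary.PropositionalEquality
  using (_≡_; refl; sym; trans; cong; subst)
open import Relation.Nullary.Decidable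
  using (Dec; yes; no; map′; ¬?; _×-dec_; _→-dec_; via-injection)
open import Relation.Nullary.Negation.Core using (¬_)
open import Relation.Unary using (Pred; Decidable; _∈_; _⊆_; _≐_; _∩_; _∪_)
open import Level using (0ℓ)

-- Search and enumeration over finite sets.

private
  variable
    A B C : Set

finite-⊥ : Finite ⊥
finite-⊥ = 0 , ↔-sym Fin.0↔⊥

finite-⊤ : Finite ⊤
finite-⊤ = 1 , ↔-sym Fin.1↔⊤

finite-≟ : Finite A → DecidableEquality A
finite-≟ (_ , A↔k) = via-injection (↔⇒↣ A↔k) Fin._≟_

-- Finiteness takes the place of excluded middle: this search makes `OutPort`, a negated existential
-- over inflows, decidable.
finite-any? : Finite A → {Q : Pred A 0ℓ} → Decidable Q → Dec (∃ Q)
finite-any? (_ , A↔k) {Q} Q? = map′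
  (λ (i , q) → from i , q)
  (λ (x , q) → to x , subst Q (sym (strictlyInverseʳ x)) q)
  (Fin.any? (Q? ∘ from))
  where open Inverse A↔k

finite-all? : Finite A → {Q : Pred A 0ℓ} → Decidable Q → Dec (∀ x → Q x)
finite-all? (_ , A↔k) {Q} Q? = map′
  (λ q x → subst Q (strictlyInverseʳ x) (q (to x)))
  (λ q i → q (from i))
  (Fin.all? (Q? ∘ from))
  where open Inverse A↔k

-- Needed so that the left leg of the span, given on ports by lookup in a list of control outports,
-- is a monomorphism.
lookup-injective : {xs : List A} → Unique xs → Injective _≡_ _≡_ (lookup xs)
lookup-injective (_ ∷ _)    {zero}  {zero}  _  = refl
lookup-injective (x∉xs ∷ _) {zero}  {suc j} eq =
  ⊥-elim (All.lookup x∉xs (∈-lookup j) eq)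
lookup-injective (x∉xs ∷ _) {suc i} {zero}  eq =
  ⊥-elim (All.lookup x∉xs (∈-lookup i) (sym eq))
lookup-injective (_ ∷ xs!)  {suc i} {suc j} eq = cong suc (lookup-injective xs! eq)

-- Listing a decidable subset avoids Σ-types over negated predicates, whose
-- elements cannot be compared without function extensionality.
enumerate-subset : Finite A → {Q : Pred A 0ℓ} → Decidable Q →
                   ∃ λ k → ∃ λ (e : Fin k → A) →
                     Injective _≡_ _≡_ e × range e ≐ Q
enumerate-subset {A} (k , A↔k) {Q} Q? =
  length xs , lookup xs , lookup-injective xs-unique ,
  (λ { (i , refl) → proj₂ (∈-filter⁻ Q? {xs = elements} (∈-lookup {xs = xs} i)) }) ,
  λ {x} q → let x∈xs = ∈-filter⁺ Q? (complete x) q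
            in index x∈xs , sym (lookup-index x∈xs)
  where
  open Inverse A↔k

  elements : List A
  elements = map from (allFin k)

  complete : ∀ x → x ∈ˡ elements
  complete x = subst (_∈ˡ elements)
                 (strictlyInverseʳ x) (∈-map⁺ from (∈-allFin (to x)))

  xs : List A
  xs = filter Q? elements

  xs-unique : Unique xs
  xs-unique = filter⁺ Q? (map⁺ (λ {i} {j} eq →
    trans (sym (strictlyInverseˡ i)) (trans (cong to eq) (strictlyInverseˡ j)))
    (allFin⁺ k))

-- Two pushouts of sets.

-- Over an empty corner the commutation condition is vacuous, so the pushout is the coproduct. This
-- covers units, inflows and outflows, since the middle of the span is trivial.
pushout-empty : ¬ A → {g : A → B} {h : A → C} → IsPushout g h inj₁ inj₂
pushout-empty ¬a = record
  { commutes  = ⊥-elim ∘ ¬a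
  ; universal = λ k l _ →
      [ k , l ]′ , ((λ _ → refl) , λ _ → refl) ,
      λ (u₁ , u₂) → [ sym ∘ u₁ , sym ∘ u₂ ]
  }

-- On the summand `A` a cocone map `l` is already determined by `k`; only its restriction to `C` is
-- free. This covers ports.
pushout-inj₁ : (g : A → B) → IsPushout g (inj₁ {B = C}) inj₁ (Sum.map₁ g)
pushout-inj₁ g = record
  { commutes  = λ _ → refl
  ; universal = λ k l k∘g≗l∘inj₁ →
      [ k , l ∘ inj₂ ]′ , ((λ _ → refl) , [ k∘g≗l∘inj₁ , (λ _ → refl) ]) ,
      λ (u₁ , u₂) → [ sym ∘ u₁ , sym ∘ u₂ ∘ inj₂ ]
  }

-- The glue, the span attaching it, and the pushout.

module _ (S : Signature) where
  open Signature S

  -- `n` is not syntactically a successor, so type 0 has to be built from the bound `n≥1`.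
  control : Fin n
  control = fromℕ< n≥1

  toℕ-control : toℕ control ≡ 0
  toℕ-control = Fin.toℕ-fromℕ< n≥1

  module _ (finite : Finite A) (a : A) where

    -- Without flows every port is both an inport and an outport, so the single point `a` supplies
    -- both required control ports.
    trivial-computon : Computon S
    trivial-computon = record
      { U = ⊥ ; P = A ; I = ⊥ ; O = ⊥
      ; finite-U = finite-⊥
      ; finite-P = finite
      ; finite-I = finite-⊥
      ; finite-O = finite-⊥
      ; σ = id ; t = λ () ; τ = id ; s = λ ()
      ; c = const control
      ; r = id
      ; f = λ ()
      ; f∈devices = λ ()
      ; σ-surjective = λ ()
      ; τ-surjective = λ ()
      ; r-surjective = λ ()
      ; τ-control-surjective = λ ()
      ; σ-control-surjective = λ ()
      ; σ∘r≗τ = λ ()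
      ; has-control-inport = a , (λ ()) , toℕ-control
      ; has-control-outport = a , (λ ()) , toℕ-control
      }

    -- The ports are by definition the disjoint union of inflows and outflows, with `s` and `t` the
    -- injections, so the identity bijection witnesses primitivity.
    glue : Computon S
    glue = record
      { U = ⊤ ; P = A ⊎ ⊤ ; I = A ; O = ⊤
      ; finite-U = finite-⊤
      ; finite-P = finite-⊎ finite finite-⊤
      ; finite-I = finite
      ; finite-O = finite-⊤
      ; σ = id ; t = inj₂ ; τ = const tt ; s = inj₁
      ; c = const control
      ; r = const tt
      ; f = const ε
      ; f∈devices = λ _ → ε∈devices
      ; σ-surjective = λ _ → tt , refl
      ; τ-surjective = λ _ → a , refl
      ; r-surjective = λ _ → a , refl
      ; τ-control-surjective = λ _ → a , toℕ-control , refl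
      ; σ-control-surjective = λ _ → tt , toℕ-control , refl
      ; σ∘r≗τ = λ _ → refl
      ; has-control-inport = inj₁ a , (λ ()) , toℕ-control
      ; has-control-outport = inj₂ tt , (λ ()) , toℕ-control
      }

    glue-isGlue : Glue glue
    glue-isGlue = record
      { isPrimitive = record
        { one-unit    = ↔-sym Fin.1↔⊤
        ; P↔I⊎O       = ↔-id _
        ; s-injective = inj₁-injective
        ; t-injective = inj₂-injective
        }
      ; all-control = λ _ → toℕ-control
      }

    glue-inports : range inj₁ ≐ Computon.InPort glue
    glue-inports = (λ { (_ , refl) () }) ,
      λ { {inj₁ x} _ → x , refl ; {inj₂ _} inp → ⊥-elim (inp (tt , refl)) }

    -- Inflow ports receive no outflow and the outflow port feeds no inflow. The boundary condition
    -- of `ι₂` is therefore automatic.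
    glue-boundary : ∀ p → p ∈ Computon.InPort glue ∪ Computon.OutPort glue
    glue-boundary (inj₁ _) = inj₁ λ ()
    glue-boundary (inj₂ _) = inj₂ λ ()

    module _ (L : Computon S) (e : A → Computon.P L)
             (range-e⊆ : range e ⊆ Computon.OutPort L ∩ Computon.Control L) where
      private
        module L = Computon L

      glue-span : Span L glue
      glue-span = record
        { L₀ = trivial-computon
        ; α₁ = record
          { mapU = λ () ; mapP = e ; mapI = λ () ; mapO = λ ()
          ; comm-τ = λ () ; comm-σ = λ () ; comm-s = λ ()
          ; comm-t = λ () ; comm-r = λ () ; comm-f = λ ()
          -- `Control` only states that `toℕ` gives 0; equality in `Fin n` follows by injectivity of
          -- `toℕ`.
          ; comm-c = λ x → Fin.toℕ-injective
              (trans (proj₂ (range-e⊆ (x , refl))) (sym toℕ-control))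
          ; boundary = λ _ → inj₁ λ ()
          }
        ; α₂ = record
          { mapU = λ () ; mapP = inj₁ ; mapI = λ () ; mapO = λ ()
          ; comm-τ = λ () ; comm-σ = λ () ; comm-s = λ ()
          ; comm-t = λ () ; comm-r = λ () ; comm-f = λ ()
          ; comm-c = λ _ → refl
          ; boundary = λ _ → inj₁ λ ()
          }
        }

      glue-span-sequentiable : Injective _≡_ _≡_ e → Sequentiable glue-span
      glue-span-sequentiable e-injective = record
        { trivial = record { no-U = id ; no-I = id ; no-O = id }
        ; mono₁   = record
          { injective-U = λ { {()} } ; injective-P = e-injective
          ; injective-I = λ { {()} } ; injective-O = λ { {()} }
          }
        ; mono₂   = record
          { injective-U = λ { {()} } ; injective-P = inj₁-injective
          ; injective-I = λ { {()} } ; injective-O = λ { {()} }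
          }
        ; range₁  = proj₁ ∘ range-e⊆
        ; range₂  = proj₁ glue-inports
        }

      -- The inflow ports of the glue are absorbed into `L.P` through `e`, so `s` ends in `inj₁` on
      -- both summands of the inflows.
      glued : Computon S
      glued = record
        { U = L.U ⊎ ⊤ ; P = L.P ⊎ ⊤ ; I = L.I ⊎ A ; O = L.O ⊎ ⊤
        ; finite-U = finite-⊎ L.finite-U finite-⊤
        ; finite-P = finite-⊎ L.finite-P finite-⊤
        ; finite-I = finite-⊎ L.finite-I finite
        ; finite-O = finite-⊎ L.finite-O finite-⊤
        ; σ = Sum.map₁ L.σ
        ; t = Sum.map₁ L.t
        ; τ = Sum.map L.τ (const tt)
        ; s = inj₁ ∘ [ L.s , e ]′
        ; c = [ L.c , const control ]′
        ; r = Sum.map L.r (const tt)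
        ; f = [ L.f , const ε ]′
        ; f∈devices = [ L.f∈devices , (λ _ → ε∈devices) ]
        ; σ-surjective = λ where
            (inj₁ u) → let o , eq = L.σ-surjective u in inj₁ o , cong inj₁ eq
            (inj₂ _) → inj₂ tt , refl
        ; τ-surjective = λ where
            (inj₁ u) → let i , eq = L.τ-surjective u in inj₁ i , cong inj₁ eq
            (inj₂ _) → inj₂ a , refl
        ; r-surjective = λ where
            (inj₁ o) → let i , eq = L.r-surjective o in inj₁ i , cong inj₁ eq
            (inj₂ _) → inj₂ a , refl
        ; τ-control-surjective = λ where
            (inj₁ u) → let i , ctl , eq = L.τ-control-surjective u
                       in inj₁ i , ctl , cong inj₁ eq
            -- The new unit reads from `e a`, a port of `L`, whose type is known only through
            -- `range-e⊆`.
            (inj₂ _) → inj₂ a , proj₂ (range-e⊆ (a , refl)) , refl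
        ; σ-control-surjective = λ where
            (inj₁ u) → let o , ctl , eq = L.σ-control-surjective u
                       in inj₁ o , ctl , cong inj₁ eq
            (inj₂ _) → inj₂ tt , toℕ-control , refl
        ; σ∘r≗τ = [ cong inj₁ ∘ L.σ∘r≗τ , (λ _ → refl) ]
        ; has-control-inport =
            let p , inp , ctl = L.has-control-inport
            in inj₁ p , (λ { (inj₁ o , eq) → inp (o , inj₁-injective eq) }) , ctl
        -- Outports of `L` in the range of `e` now feed the glue, so the target of the new outflow
        -- is chosen; no inflow starts there.
        ; has-control-outport = inj₂ tt , (λ { (_ , ()) }) , toℕ-control
        }

      glue-pushout : Pushout glue-span
      glue-pushout = record
        { apex = glued
        ; ι₁ = record
          { mapU = inj₁ ; mapP = inj₁ ; mapI = inj₁ ; mapO = inj₁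
          ; comm-τ = λ _ → refl ; comm-σ = λ _ → refl ; comm-s = λ _ → refl
          ; comm-t = λ _ → refl ; comm-r = λ _ → refl ; comm-f = λ _ → refl
          ; comm-c = λ _ → refl
          -- Flows of `L` contribute only units in the image of `inj₁`, and the new outflow targets
          -- a port outside `L.P`. New adjacency thus arises only at some `e x`, which is an outport
          -- of `L`.
          ; boundary = λ where
              (inj₁ (_ , (inj₁ o , eq , refl) , u∉)) →
                ⊥-elim (u∉ (L.σ o , (o , inj₁-injective eq , refl) , refl))
              (inj₂ (_ , (inj₁ i , eq , refl) , u∉)) →
                ⊥-elim (u∉ (L.τ i , (i , inj₁-injective eq , refl) , refl))
              (inj₂ (_ , (inj₂ x , eq , _) , _)) →
                inj₂ (proj₁ (range-e⊆ (x , inj₁-injective eq)))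
          }
        ; ι₂ = record
          { mapU = inj₂ ; mapP = Sum.map₁ e ; mapI = inj₂ ; mapO = inj₂
          ; comm-τ = λ _ → refl ; comm-σ = λ _ → refl ; comm-s = λ _ → refl
          ; comm-t = λ _ → refl ; comm-r = λ _ → refl ; comm-f = λ _ → refl
          ; comm-c = λ where
              (inj₁ x) → Fin.toℕ-injective
                (trans (proj₂ (range-e⊆ (x , refl))) (sym toℕ-control))
              (inj₂ _) → refl
          ; boundary = λ {p} _ → glue-boundary p
          }
        ; pushout-U = pushout-empty id
        ; pushout-P = pushout-inj₁ e
        ; pushout-I = pushout-empty id
        ; pushout-O = pushout-empty id
        }

-- Attaching a glue to an arbitrary computon.

module _ {S : Signature} (L : Computon S) where
  open Computon L

  outPort? : Decidable OutPort
  outPort? p = ¬? (finite-any? finite-I λ i → finite-≟ finite-P (s i) p)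

  control? : Decidable Control
  control? p = toℕ (c p) ℕ.≟ 0

  all-outports-control? : Dec (OutPort ⊆ Control)
  all-outports-control? = map′ (λ h {p} → h p) (λ h p → h {p})
    (finite-all? finite-P λ p → outPort? p →-dec control? p)

  -- The right leg always covers all inports of the glue, so the composite is total exactly when
  -- every outport of `L` is control, which is decidable.
  sync-with-glue : ∃ λ (G : Computon S) → Glue G ×
    (∃ λ (ρ : Span L G) →
      Sequentiable ρ × IdentifiesControl ρ ×
      (PartialSequential ρ ⊎ TotalSequential ρ))
  sync-with-glue =
    let k , e , e-injective , range-e⊆ , range-e⊇ =
          enumerate-subset finite-P λ p → outPort? p ×-dec control? p
        -- The index of this control outport in the enumeration makes `Fin k` inhabited, as the glue
        -- requires.
        _ , outp = has-control-outport
        a , _ = range-e⊇ outp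
        fin = k , ↔-id (Fin k)
        G-inports = glue-inports S fin a
        seq = glue-span-sequentiable S fin a L e range-e⊆ e-injective
        po = glue-pushout S fin a L e range-e⊆
    in glue S fin a , glue-isGlue S fin a , glue-span S fin a L e range-e⊆ ,
       seq , ((range-e⊆ , range-e⊇) , G-inports) ,
       (case all-outports-control? of λ where
         (yes out⊆ctl) → inj₂ record
           { sequentiable = seq
           ; total        = (proj₁ ∘ range-e⊆ , λ o → range-e⊇ (o , out⊆ctl o)) , G-inports
           ; pushout      = po
           }
         (no ¬out⊆ctl) → inj₁ record
           { sequentiable = seq
           -- Totality would put every outport in the range of `e`, hence among the control ports.
           ; not-total    = λ ((_ , out⊆range) , _) →
               ¬out⊆ctl (proj₂ ∘ range-e⊆ ∘ out⊆range)
           ; pushout      = po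
           })

theorem9 : (S : Signature) (L₁ L₂ : Computon S) →
    ∃ λ (L₃ : Computon S) → Glue L₃ ×
    (∃ λ (ρ : Span (L₁ + L₂) L₃) →
    Sequentiable ρ × IdentifiesControl ρ ×
    (PartialSequential ρ ⊎ TotalSequential ρ))
theorem9 S L₁ L₂ = sync-with-glue (L₁ + L₂)
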